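{- Let $\mathcal{A} = (A, \_[\_/\_])$ be a renset, let $x \in \mathsf{Var}$ and $a \in A$. The following are equivalent: (1) the set $\{y \in \mathsf{Var} \mid a[y/x] \neq a\}$ is finite; (2) $a[y/x] = a$ for all $y \in \mathsf{Var}$; (3) $a[y/x] = a$ for some $y \in \mathsf{Var} \setminus \{x\}$.
   Context: $\mathsf{Var}$ is a fixed countably infinite set (of variables). A renaming-enriched set (renset) is a pair $\mathcal{A} = (A, \_[\_/\_])$ where $A$ is a set and $\_[\_/\_] : A \to \mathsf{Var} \to \mathsf{Var} \to A$ is an operator (the renaming operator; $a[y/x]$ is read as the result of substituting $x$ with $y$ in $a$) such that for all $x, x_1, x_2, x_3, y, y_1, y_2 \in \mathsf{Var}$ and $a \in A$: - Identity: $a[x/x] = a$; - Idempotence: if $x_1 \neq y$ then $a[x_1/y][x_2/y] = a[x_1/y]$; - Chaining: if $y \neq x_2$ then $a[y/x_2][x_2/x_1][x_3/x_2] = a[y/x_2][x_3/x_1]$; - Commutativity: if $x_2 \neq y_1 \neq x_1 \neq y_2$ (i.e., $x_2 \neq y_1$, $y_1 \neq x_1$ and $x_1 \neq y_2$) then $a[x_2/x_1][y_2/y_1] = a[y_2/y_1][x_2/x_1]$. -}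

module Defs where

open import Data.List using (List)
open import Data.List.Membership.Propositional using (_∈_)
open import Data.Product using (∃)
open import Function.Bundles using (_⇔_)
open import Level using (Level; _⊔_; suc)
open import Relation.Binary.PropositionalEquality using (_≡_; _≢_)
open import Relation.Unary using (Pred)

private
  variable
    v ℓ p : Level

-- a [ y / x ] substitutes x with y in a: the variable being replaced comes last.
record Renset (Var : Set v) (ℓ : Level) : Set (v ⊔ suc ℓ) where
  infixl 20 _[_/_]
  field
    Carrier       : Set ℓ
    _[_/_]        : Carrier → Var → Var → Carrier
    identity      : ∀ x a → a [ x / x ] ≡ a
    idempotence   : ∀ x₁ x₂ y a → x₁ ≢ y →
                    a [ x₁ / y ] [ x₂ / y ] ≡ a [ x₁ / y ]
    chaining      : ∀ x₁ x₂ x₃ y a → y ≢ x₂ →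
                    a [ y / x₂ ] [ x₂ / x₁ ] [ x₃ / x₂ ] ≡ a [ y / x₂ ] [ x₃ / x₁ ]
    commutativity : ∀ x₁ x₂ y₁ y₂ a → x₂ ≢ y₁ → y₁ ≢ x₁ → x₁ ≢ y₂ →
                    a [ x₂ / x₁ ] [ y₂ / y₁ ] ≡ a [ y₂ / y₁ ] [ x₂ / x₁ ]

-- The subset { y | P y } is finite: its members are exactly the entries of
-- some list, repetitions being allowed.
Finite : {X : Set v} → Pred X p → Set (v ⊔ p)
Finite {X = X} P = ∃ λ (ys : List X) → ∀ y → P y ⇔ y ∈ ys

{-# OPTIONS --safe #-}
module Submission where

open import Defs
open import Axiom.DoubleNegationElimination using (em⇒dne)
open import Axiom.ExcludedMiddle using (ExcludedMiddle)
open import Data.List using (List; []; _∷_; map)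
open import Data.List.Extrema.Nat using (max; xs≤max)
open import Data.List.Membership.Propositional using (_∈_; _∉_)
open import Data.List.Membership.Propositional.Properties using (∈-map⁺)
open import Data.List.Relation.Unary.All using (lookup)
open import Data.List.Relation.Unary.Any using (here; there)
open import Data.Nat using (ℕ; suc)
open import Data.Nat.Properties using (<-irrefl; ≤-trans; ≤-reflexive)
open import Data.Product using (_×_; ∃; _,_; proj₁; proj₂)
open import Function using (_∘_)
open import Function.Bundles using (_⇔_; _⤖_; mk⇔; Equivalence; Bijection)
open import Level using (Level)
open import Relation.Binary.PropositionalEquality
  using (_≡_; _≢_; refl; sym; trans; cong)
open import Relation.Nullary using (contradiction)

-- Everything reduces to a single fixed point: if `a [ y / x ] ≡ a` for one `y ≢ x`, idempotence
-- gives the same for every `z` (`fixed-once⇒fixed`). Since `Var` is infinite, a variable can be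
-- chosen outside any finite list (`fresh`); when only finitely many variables move `a`, this
-- supplies such a `y`. The remaining directions are immediate, given a variable other than `x`.

fresh : ∀ {v} {Var : Set v} → Var ⤖ ℕ → (xs : List Var) → ∃ λ y → y ∉ xs
fresh Var⤖ℕ xs = y , λ y∈xs →
  -- Membership of `y` in `xs` would give `suc m ≤ to y ≤ m`.
  <-irrefl refl (≤-trans (≤-reflexive (sym to-y≡1+m)) (lookup (xs≤max 0 (map to xs)) (∈-map⁺ to y∈xs)))
  where
  open Bijection Var⤖ℕ using (to; strictlySurjective)
  m = max 0 (map to xs)
  y = proj₁ (strictlySurjective (suc m))
  to-y≡1+m : to y ≡ suc m
  to-y≡1+m = proj₂ (strictlySurjective (suc m))

module _ {v ℓ} {Var : Set v} (𝒜 : Renset Var ℓ) where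
  open Renset 𝒜

  -- Once `x` has been replaced by `y ≢ x`, renaming `x` again has no effect, so `a [ z / x ] ≡ a
  -- [ y / x ] [ z / x ] ≡ a [ y / x ] ≡ a`.
  fixed-once⇒fixed : ∀ {x y a} → y ≢ x → a [ y / x ] ≡ a → ∀ z → a [ z / x ] ≡ a
  fixed-once⇒fixed {x} {y} {a} y≢x a[y/x]≡a z =
    trans (cong (_[ z / x ]) (sym a[y/x]≡a)) (trans (idempotence y z x a y≢x) a[y/x]≡a)

mainTheorem1 : ∀ {v ℓ : Level} → ExcludedMiddle ℓ →
    {Var : Set v} → Var ⤖ ℕ →
    (𝒜 : Renset Var ℓ) → let open Renset 𝒜 in
    (x : Var) (a : Carrier) →
    (Finite (λ y → a [ y / x ] ≢ a) ⇔ (∀ y → a [ y / x ] ≡ a)) ×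
    ((∀ y → a [ y / x ] ≡ a) ⇔ (∃ λ y → y ≢ x × a [ y / x ] ≡ a))
mainTheorem1 em Var⤖ℕ 𝒜 x a =
  mk⇔ finite⇒fixed (λ fixed → [] , λ y → mk⇔ (contradiction (fixed y)) (λ ())) ,
  mk⇔ fixed⇒fixed-once (λ (_ , y≢x , eq) → fixed-once⇒fixed 𝒜 y≢x eq)
  where
  open Renset 𝒜

  finite⇒fixed : Finite (λ y → a [ y / x ] ≢ a) → ∀ y → a [ y / x ] ≡ a
  finite⇒fixed (ys , moved⇔∈ys) =
    -- Adding `x` to the list makes the same `y` both distinct from `x` and outside `ys`. The latter
    -- only refutes `a [ y / x ] ≢ a`, so the equality itself comes from excluded middle.
    let y , y∉x∷ys = fresh Var⤖ℕ (x ∷ ys) in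
    fixed-once⇒fixed 𝒜 (y∉x∷ys ∘ here)
      (em⇒dne em (y∉x∷ys ∘ there ∘ Equivalence.to (moved⇔∈ys y)))

  fixed⇒fixed-once : (∀ y → a [ y / x ] ≡ a) → ∃ λ y → y ≢ x × a [ y / x ] ≡ a
  fixed⇒fixed-once fixed =
    let y , y∉[x] = fresh Var⤖ℕ (x ∷ []) in y , y∉[x] ∘ here , fixed y
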